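{- There is a function $f(h,k)$ on positive integers $h$ and $k$ such that every $h$-semicomplete digraph with pathwidth at least $f(h,k)$ has a semicomplete subgraph of pathwidth at least $k$.
   Context: Digraphs are simple: no self-loops, and between each pair of distinct vertices at most one edge in each direction. A non-neighbor of a vertex $v$ is a vertex $u\neq v$ with no edge between $u$ and $v$ in either direction. A digraph is $h$-semicomplete if each vertex has at most $h$ non-neighbors; it is semicomplete if it is $0$-semicomplete. A path-decomposition of a digraph $G$ is a sequence $(X_1,\dots,X_m)$ of subsets of $V(G)$ such that (1) $\bigcup_i X_i=V(G)$; (2) for each edge $(u,v)$ there are $i\ge j$ with $u\in X_i$, $v\in X_j$; (3) for each vertex $v$, $\{i: v\in X_i\}$ is an integer interval. Its width is $\max_i|X_i|-1$; the pathwidth is the minimum width of a path-decomposition. -}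

module Defs where

open import Data.Nat using (ℕ; zero; suc; _+_; _≤_; _<_)
open import Data.Bool using (Bool; true; false; not; _∧_; if_then_else_)
open import Data.Fin using (Fin; _≟_) renaming (_≤_ to _≤ᶠ_)
open import Data.Fin.Subset using (Subset; _∈_; ∣_∣)
open import Data.Product using (Σ; ∃; ∃-syntax; _×_; _,_)
open import Relation.Nullary using (¬_; does)
open import Relation.Binary.PropositionalEquality using (_≡_)
open import Function using (_∘_)
open import Function.Definitions using (Injective)

record Digraph : Set where
  field
    n      : ℕ
    E      : Fin n → Fin n → Bool
    noLoop : ∀ v → E v v ≡ false
open Digraph public

countB : ∀ {m} → (Fin m → Bool) → ℕ
countB {zero}  p = 0
countB {suc m} p = (if p Fin.zero then 1 else 0) + countB (p ∘ Fin.suc)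

nonNeighbour : (G : Digraph) → Fin (n G) → Fin (n G) → Bool
nonNeighbour G v u = not (does (u ≟ v)) ∧ not (E G u v) ∧ not (E G v u)

SemicompleteH : ℕ → Digraph → Set
SemicompleteH h G = ∀ v → countB (nonNeighbour G v) ≤ h

Semicomplete : Digraph → Set
Semicomplete = SemicompleteH 0

record PathDecomposition (G : Digraph) : Set where
  field
    m      : ℕ
    X      : Fin m → Subset (n G)
    cover  : ∀ v → ∃[ i ] v ∈ X i
    edges  : ∀ u v → E G u v ≡ true →
             ∃[ i ] ∃[ j ] (j ≤ᶠ i × u ∈ X i × v ∈ X j)
    interval : ∀ v (i j k : Fin m) → i ≤ᶠ j → j ≤ᶠ k →
               v ∈ X i → v ∈ X k → v ∈ X j
open PathDecomposition public

-- width (max_i |X_i| - 1) is at least p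
WidthAtLeast : {G : Digraph} → PathDecomposition G → ℕ → Set
WidthAtLeast D p = ∃[ i ] suc p ≤ ∣ X D i ∣

PathwidthAtLeast : Digraph → ℕ → Set
PathwidthAtLeast G p = (D : PathDecomposition G) → WidthAtLeast D p

IsSubgraph : Digraph → Digraph → Set
IsSubgraph H G =
  Σ (Fin (n H) → Fin (n G)) λ φ →
    Injective _≡_ _≡_ φ ×
    (∀ a b → E H a b ≡ true → E G (φ a) (φ b) ≡ true)

{-# OPTIONS --safe #-}
module Submission where

-- In a clique, let r be the earliest among the last bags of given vertices v_i of a path decomposition.
-- If u_i = v_i or u_i → v_i for k + 1 disjoint pairs, and k + 1 paths of length two lead from each v_i
-- to each u_j, then bag r contains u_i or v_i for every i, or else all the middle vertices from some
-- v_i to some u_j.  Either way the pathwidth is at least k.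
--
-- In an h-semicomplete digraph the number of such paths from v to u is, up to h + 1, at least
-- |N⁺(v) \ N⁺(u)|.  Since every vertex excludes at most h others, sufficiently many pairs with all these
-- differences large yield, by greedy choice, a semicomplete subgraph of the above kind.
--
-- To find the pairs, order the vertices by out-degree.  Each vertex v is present at its out-degree;
-- it is extended to the left as far as it has more than K in-neighbours of smaller out-degree, and to
-- the right until its out-neighbours have appeared.  A large bag at c contains many vertices of one
-- of three kinds.  If their out-degrees are far above or far below c, there is a large matching from
-- low to high out-degree, and high minus low out-degree bounds |N⁺(v) \ N⁺(u)| from below.  If their
-- out-degrees are near c, then either many of them differ pairwise, giving pairs with u_i = v_i, or
-- many have nearly the same out-neighbourhood as some x; among the latter, those inside N⁺(x) contain
-- a clique of large minimum out-degree, which also forces large pathwidth.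

open import Defs
open import Data.Bool using (true; false)
import Data.Bool.Properties as Bool
open import Data.Fin using (Fin; zero; suc; toℕ; fromℕ<) renaming (_≤_ to _≤ᶠ_)
import Data.Fin.Properties as Fin
open import Data.Fin.Subset using (Subset; inside; outside; ∣_∣) renaming (_∈_ to _∈ˢ_)
open import Data.Fin.Subset.Properties using () renaming (_∈?_ to _∈ˢ?_)
open import Data.List using (List; []; _∷_; _++_; length; map; filter; lookup; allFin; cartesianProduct; deduplicate)
open import Data.List.Membership.Propositional using (_∈_; _∉_; find; lose)
open import Data.List.Membership.Propositional.Properties using (∈-filter⁺; ∈-filter⁻; ∈-map⁺; ∈-map⁻; ∈-++⁺ˡ; ∈-++⁺ʳ; ∈-++⁻; ∈-allFin; ∈-lookup; ∈-AllPairs₂; ∈-cartesianProduct⁺; ∈-cartesianProduct⁻; ∈-deduplicate⁺; ∈-deduplicate⁻)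
open import Data.List.Properties using (length-filter; length-map; length-++; length-tabulate; filter-all; filter-accept; filter-notAll)
open import Data.List.Relation.Binary.Subset.Propositional using (_⊆_)
open import Data.List.Relation.Unary.All as All using (All; []; _∷_)
import Data.List.Relation.Unary.All.Properties as All
open import Data.List.Relation.Unary.AllPairs as AllPairs using (AllPairs; []; _∷_)
import Data.List.Relation.Unary.AllPairs.Properties as AllPairs
open import Data.List.Relation.Unary.Any as Any using (here; there)
import Data.List.Relation.Unary.Any.Properties as Any
open import Data.List.Relation.Unary.Unique.Propositional using (Unique)
import Data.List.Relation.Unary.Unique.Propositional.Properties as Unique
open import Data.List.Relation.Unary.Unique.DecPropositional.Properties using (deduplicate-!)
open import Data.Nat using (ℕ; zero; suc; _+_; _*_; _≤_; _<_; z≤n; s≤s; _≤?_; _<?_)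
open import Data.Nat.Properties
open import Data.Product using (Σ; ∃; ∃-syntax; _×_; _,_; proj₁; proj₂)
open import Data.Sum using (_⊎_; inj₁; inj₂; [_,_]′) renaming (map to map-⊎)
open import Data.Unit using (⊤; tt)
open import Data.Vec using (tabulate; []; _∷_)
import Data.Vec as Vec
open import Data.Vec.Properties using ([]=⇒lookup; lookup⇒[]=; lookup∘tabulate)
open import Function using (_∘_; id; _on_)
open import Function.Definitions using (Injective)
open import Level using (0ℓ)
open import Relation.Binary using (Rel) renaming (Decidable to Decidable₂)
open import Relation.Binary.PropositionalEquality using (_≡_; _≢_; refl; sym; trans; cong; cong₂; subst; subst₂)
open import Relation.Nullary using (¬_; Dec; yes; no; does; contradiction)
open import Relation.Nullary.Decidable using (¬?; _×-dec_; _⊎-dec_; dec-true)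
open import Relation.Unary using (Pred; Decidable)

decide : {P : Set} → Dec P → P ⊎ ¬ P
decide (yes p) = inj₁ p
decide (no p)  = inj₂ p

+-≤-split : ∀ a {b x y} → a + b ≤ x + y → a ≤ x ⊎ b ≤ y
+-≤-split a {b} {x} {y} le with a ≤? x
... | yes a≤x = inj₁ a≤x
... | no a≰x  = inj₂ (+-cancelˡ-≤ x _ _ (≤-trans (+-monoˡ-≤ b (<⇒≤ (≰⇒> a≰x))) le))

-- Counting in lists

module _ {A : Set} where

  count : {P : Pred A 0ℓ} → Decidable P → List A → ℕ
  count P? xs = length (filter P? xs)

  module _ {P : Pred A 0ℓ} (P? : Decidable P) where

    count-∷ : ∀ x xs → count P? xs ≤ count P? (x ∷ xs)
    count-∷ x xs with P? x
    ... | yes _ = n≤1+n _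
    ... | no _  = ≤-refl

    count-filter : {Q : Pred A 0ℓ} (Q? : Decidable Q) → ∀ xs → count P? (filter Q? xs) ≤ count P? xs
    count-filter Q? [] = z≤n
    count-filter Q? (x ∷ xs) with Q? x
    ... | no _ = ≤-trans (count-filter Q? xs) (count-∷ x xs)
    ... | yes _ with P? x
    ...   | yes _ = s≤s (count-filter Q? xs)
    ...   | no _  = count-filter Q? xs

    count-map : {B : Set} (f : B → A) → ∀ xs → length (filter (λ x → P? (f x)) xs) ≡ count P? (map f xs)
    count-map f [] = refl
    count-map f (x ∷ xs) with P? (f x)
    ... | yes _ = cong suc (count-map f xs)
    ... | no _  = count-map f xs

  module _ {P Q R : Pred A 0ℓ} (P? : Decidable P) (Q? : Decidable Q) (R? : Decidable R) where

    count-cover : ∀ xs → (∀ {x} → x ∈ xs → P x → Q x ⊎ R x) → count P? xs ≤ count Q? xs + count R? xs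
    count-cover [] f = z≤n
    count-cover (x ∷ xs) f with P? x
    ... | no _ = ≤-trans (count-cover xs (f ∘ there)) (+-mono-≤ (count-∷ Q? x xs) (count-∷ R? x xs))
    ... | yes p with f (here refl) p
    ...   | inj₁ q rewrite filter-accept Q? {xs = xs} q =
            s≤s (≤-trans (count-cover xs (f ∘ there)) (+-monoʳ-≤ (count Q? xs) (count-∷ R? x xs)))
    ...   | inj₂ r rewrite filter-accept R? {xs = xs} r | +-suc (count Q? (x ∷ xs)) (count R? xs) =
            s≤s (≤-trans (count-cover xs (f ∘ there)) (+-monoˡ-≤ (count R? xs) (count-∷ Q? x xs)))

  module _ {P Q : Pred A 0ℓ} (P? : Decidable P) (Q? : Decidable Q) where

    -- Both sides count the elements satisfying `P` or `Q`.
    count-difference : ∀ xs → count (λ x → P? x ×-dec ¬? (Q? x)) xs + count Q? xs ≡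
                              count (λ x → Q? x ×-dec ¬? (P? x)) xs + count P? xs
    count-difference [] = refl
    count-difference (x ∷ xs) with P? x | Q? x
    ... | yes _ | yes _ = trans (+-suc _ _) (trans (cong suc (count-difference xs)) (sym (+-suc _ _)))
    ... | yes _ | no _  = trans (cong suc (count-difference xs)) (sym (+-suc _ _))
    ... | no _  | yes _ = trans (+-suc _ _) (cong suc (count-difference xs))
    ... | no _  | no _  = count-difference xs

  length-cover : {Q R : Pred A 0ℓ} (Q? : Decidable Q) (R? : Decidable R) → ∀ xs →
                 (∀ {x} → x ∈ xs → Q x ⊎ R x) → length xs ≤ count Q? xs + count R? xs
  length-cover Q? R? xs f =
    subst (λ zs → length zs ≤ count Q? xs + count R? xs) (filter-all all? (All.universal (λ _ → tt) xs))
      (count-cover all? Q? R? xs (λ x∈ _ → f x∈))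
    where
    all? : Decidable {A = A} (λ _ → ⊤)
    all? _ = yes tt

  -- Keep the head and delete what it is related to in the tail. Unless more than `N` elements go,
  -- each kept element costs at most `suc N`.
  greedy : {_~_ : Rel A 0ℓ} (_~?_ : Decidable₂ _~_) → ∀ N M xs → M * suc N ≤ length xs →
           (∃[ x ] (x ∈ xs × N < count (x ~?_) xs)) ⊎
           (∃[ ys ] (ys ⊆ xs × length ys ≡ M × AllPairs (λ x y → ¬ (x ~ y)) ys))
  greedy _~?_ N zero xs _ = inj₂ ([] , (λ ()) , refl , [])
  greedy _~?_ N (suc M) (x ∷ xs) (s≤s len) with suc N ≤? count (x ~?_) xs
  ... | yes many = inj₁ (x , here refl , ≤-trans many (count-∷ (x ~?_) x xs))
  ... | no few with greedy _~?_ N M rest enough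
    where
    rest = filter (¬? ∘ (x ~?_)) xs
    enough : M * suc N ≤ length rest
    enough = +-cancelˡ-≤ N _ _ (≤-trans len (≤-trans
      (length-cover (x ~?_) (¬? ∘ (x ~?_)) xs (λ {y} _ → decide (x ~? y)))
      (+-monoˡ-≤ (length rest) (≮⇒≥ few))))
  ...   | inj₁ (z , z∈ , many) =
          inj₁ (z , there (proj₁ (∈-filter⁻ (¬? ∘ (x ~?_)) z∈)) ,
                ≤-trans many (≤-trans (count-filter (z ~?_) (¬? ∘ (x ~?_)) xs) (count-∷ (z ~?_) x xs)))
  ...   | inj₂ (ys , ys⊆ , len-ys , sep) =
          inj₂ (x ∷ ys ,
                (λ { (here eq) → here eq ; (there y∈) → there (proj₁ (∈-filter⁻ (¬? ∘ (x ~?_)) (ys⊆ y∈))) }) ,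
                cong suc len-ys ,
                All.tabulate (λ y∈ → proj₂ (∈-filter⁻ (¬? ∘ (x ~?_)) {xs = xs} (ys⊆ y∈))) ∷ sep)

length-++-comm : {A : Set} (xs ys : List A) → length (xs ++ ys) ≡ length ys + length xs
length-++-comm xs ys = trans (length-++ xs) (+-comm (length xs) (length ys))

length-cartesianProduct : {A B : Set} (xs : List A) (ys : List B) →
                          length (cartesianProduct xs ys) ≡ length xs * length ys
length-cartesianProduct []       ys = refl
length-cartesianProduct (x ∷ xs) ys =
  trans (length-++ (map (x ,_) ys)) (cong₂ _+_ (length-map (x ,_) ys) (length-cartesianProduct xs ys))

-- Duplicate-free lists of elements of a finite set

module _ {n : ℕ} where

  unique⇒length≤ : {xs ys : List (Fin n)} → Unique xs → xs ⊆ ys → length xs ≤ length ys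
  unique⇒length≤ {[]} _ _ = z≤n
  unique⇒length≤ {x ∷ xs} {ys} (x∉ ∷ uxs) xs⊆ys =
    ≤-trans (s≤s (unique⇒length≤ uxs (λ y∈ → ∈-filter⁺ ≢x? (xs⊆ys (there y∈)) (All.lookup x∉ y∈))))
            (filter-notAll ≢x? ys (Any.map (λ eq ne → ne eq) (xs⊆ys (here refl))))
    where
    ≢x? : Decidable (x ≢_)
    ≢x? y = ¬? (x Fin.≟ y)

  count≤count-allFin : {P Q : Pred (Fin n) 0ℓ} (P? : Decidable P) (Q? : Decidable Q) {xs : List (Fin n)} →
                       Unique xs → (∀ {x} → x ∈ xs → P x → Q x) → count P? xs ≤ count Q? (allFin n)
  count≤count-allFin P? Q? {xs} uxs f = unique⇒length≤ (Unique.filter⁺ P? uxs) λ x∈ →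
    let x∈xs , px = ∈-filter⁻ P? {xs = xs} x∈ in ∈-filter⁺ Q? (∈-allFin _) (f x∈xs px)

  fresh : {ws zs : List (Fin n)} → Unique ws → length zs < length ws → ∃[ w ] (w ∈ ws × w ∉ zs)
  fresh {ws} {zs} uws len with Any.any? (λ w → ¬? (Any.any? (w Fin.≟_) zs)) ws
  ... | yes p = find p
  ... | no ¬p = contradiction (unique⇒length≤ uws ws⊆zs) (<⇒≱ len)
    where
    ws⊆zs : ws ⊆ zs
    ws⊆zs {w} w∈ with Any.any? (w Fin.≟_) zs
    ... | yes w∈zs = w∈zs
    ... | no w∉zs  = contradiction (lose w∈ w∉zs) ¬p

lookup-injective : {A : Set} {xs : List A} → Unique xs → Injective _≡_ _≡_ (lookup xs)
lookup-injective (x∉ ∷ _) {zero}  {zero}  _  = refl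
lookup-injective {xs = _ ∷ xs} (x∉ ∷ _) {zero}  {suc j} eq = contradiction eq (All.lookup x∉ (∈-lookup {xs = xs} j))
lookup-injective {xs = _ ∷ xs} (x∉ ∷ _) {suc i} {zero}  eq = contradiction (sym eq) (All.lookup x∉ (∈-lookup {xs = xs} i))
lookup-injective (_ ∷ uxs) {suc i} {suc j} eq = cong suc (lookup-injective uxs eq)

-- Subsets and Boolean counts turned into lists

elements : ∀ {n} → Subset n → List (Fin n)
elements []            = []
elements (inside ∷ S)  = zero ∷ map suc (elements S)
elements (outside ∷ S) = map suc (elements S)

length-elements : ∀ {n} (S : Subset n) → length (elements S) ≡ ∣ S ∣
length-elements []            = refl
length-elements (inside ∷ S)  = cong suc (trans (length-map suc (elements S)) (length-elements S))
length-elements (outside ∷ S) = trans (length-map suc (elements S)) (length-elements S)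

elements-unique : ∀ {n} (S : Subset n) → Unique (elements S)
elements-unique []            = []
elements-unique (inside ∷ S)  =
  All.map⁺ (All.universal (λ _ ()) (elements S)) ∷ Unique.map⁺ Fin.suc-injective (elements-unique S)
elements-unique (outside ∷ S) = Unique.map⁺ Fin.suc-injective (elements-unique S)

∈-elements⁺ : ∀ {n} {S : Subset n} {x} → x ∈ˢ S → x ∈ elements S
∈-elements⁺ {S = inside ∷ S}  Vec.here        = here refl
∈-elements⁺ {S = inside ∷ S}  (Vec.there x∈) = there (∈-map⁺ suc (∈-elements⁺ x∈))
∈-elements⁺ {S = outside ∷ S} (Vec.there x∈) = ∈-map⁺ suc (∈-elements⁺ x∈)

∈-elements⁻ : ∀ {n} {S : Subset n} {x} → x ∈ elements S → x ∈ˢ S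
∈-elements⁻ {S = inside ∷ S}  (here refl) = Vec.here
∈-elements⁻ {S = inside ∷ S}  (there x∈) with _ , y∈ , refl ← ∈-map⁻ suc x∈ = Vec.there (∈-elements⁻ y∈)
∈-elements⁻ {S = outside ∷ S} x∈         with _ , y∈ , refl ← ∈-map⁻ suc x∈ = Vec.there (∈-elements⁻ y∈)

module _ {n : ℕ} {P : Pred (Fin n) 0ℓ} (P? : Decidable P) where

  comprehension : Subset n
  comprehension = tabulate (does ∘ P?)

  ∈-comprehension⁺ : ∀ {x} → P x → x ∈ˢ comprehension
  ∈-comprehension⁺ {x} px =
    lookup⇒[]= x comprehension (trans (lookup∘tabulate (does ∘ P?) x) (dec-true (P? x) px))

  ∈-comprehension⁻ : ∀ {x} → x ∈ˢ comprehension → P x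
  ∈-comprehension⁻ {x} x∈ with P? x | trans (sym (lookup∘tabulate (does ∘ P?) x)) ([]=⇒lookup x∈)
  ... | yes px | _ = px
  ... | no _   | ()

countB≡∣tabulate∣ : ∀ {n} (p : Fin n → _) → countB p ≡ ∣ tabulate p ∣
countB≡∣tabulate∣ {zero}  p = refl
countB≡∣tabulate∣ {suc n} p with p zero
... | true  = cong suc (countB≡∣tabulate∣ (p ∘ suc))
... | false = countB≡∣tabulate∣ (p ∘ suc)

unique⇒length≤countB : ∀ {n} (p : Fin n → _) {xs} → Unique xs → (∀ {x} → x ∈ xs → p x ≡ true) → length xs ≤ countB p
unique⇒length≤countB p {xs} uxs f =
  subst (length xs ≤_) (trans (length-elements (tabulate p)) (sym (countB≡∣tabulate∣ p)))
    (unique⇒length≤ uxs λ {x} x∈ →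
      ∈-elements⁺ (lookup⇒[]= x (tabulate p) (trans (lookup∘tabulate p x) (f x∈))))

countB-false : ∀ {n} (p : Fin n → _) → (∀ x → p x ≡ false) → countB p ≡ 0
countB-false {zero}  p f = refl
countB-false {suc n} p f rewrite f zero = countB-false (p ∘ suc) (f ∘ suc)

-- Last indices and choices along lists

last : ∀ {m} {P : Pred (Fin m) 0ℓ} → Decidable P → ∃ P → ∃[ r ] (P r × ∀ i → P i → i ≤ᶠ r)
last {suc m} P? (i , pi) with Fin.any? (P? ∘ suc)
... | yes p with r , pr , max ← last (P? ∘ suc) p = suc r , pr , λ { zero _ → z≤n ; (suc j) pj → s≤s (max j pj) }
last {suc m} P? (zero  , pi) | no ¬p = zero , pi , λ { zero _ → z≤n ; (suc j) pj → contradiction (j , pj) ¬p }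
last {suc m} P? (suc i , pi) | no ¬p = contradiction (i , pi) ¬p

-- `B` stands for bag membership. If the head ends before the tail's candidate does, every bag after
-- the old `r` is also after the new one.
earliestEnd : {A : Set} {m : ℕ} {B : Fin m → A → Set} → (∀ i x → Dec (B i x)) → ∀ x xs →
              (∀ {y} → y ∈ x ∷ xs → ∃[ i ] B i y) →
              ∃[ r ] ∃[ z ] (z ∈ x ∷ xs × B r z × (∀ i → B i z → i ≤ᶠ r) ×
                             (∀ {y} → y ∈ x ∷ xs → ∃[ i ] (r ≤ᶠ i × B i y)))
earliestEnd B? x [] ne with r , br , max ← last (λ i → B? i x) (ne (here refl)) =
  r , x , here refl , br , max , λ { (here refl) → r , ≤-refl , br }
earliestEnd B? x (x′ ∷ xs) ne
  with last (λ i → B? i x) (ne (here refl)) | earliestEnd B? x′ xs (ne ∘ there)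
... | s , bs , max-s | r , z , z∈ , br , max-r , ends with Fin.≤-total s r
...   | inj₁ s≤r = s , x , here refl , bs , max-s ,
        λ { (here refl) → s , ≤-refl , bs
          ; (there y∈) → let i , r≤i , bi = ends y∈ in i , ≤-trans s≤r r≤i , bi }
...   | inj₂ r≤s = r , z , there z∈ , br , max-r ,
        λ { (here refl) → s , r≤s , bs ; (there y∈) → ends y∈ }

All-⊎ : {A : Set} {P : Pred A 0ℓ} {Q : Set} (xs : List A) → (∀ {x} → x ∈ xs → P x ⊎ Q) → All P xs ⊎ Q
All-⊎ []       f = inj₁ []
All-⊎ (x ∷ xs) f with f (here refl) | All-⊎ xs (f ∘ there)
... | inj₂ q | _       = inj₂ q
... | inj₁ _ | inj₂ q  = inj₂ q
... | inj₁ p | inj₁ ps = inj₁ (p ∷ ps)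

pairUp : {A B : Set} {R : A → B → Set} (xs : List A) → (∀ {x} → x ∈ xs → ∃[ y ] R x y) →
         ∃[ ps ] (map proj₁ ps ≡ xs × (∀ {x y} → (x , y) ∈ ps → R x y))
pairUp []       f = [] , refl , λ ()
pairUp (x ∷ xs) f with f (here refl) | pairUp xs (f ∘ there)
... | y , r | ps , refl , good = (x , y) ∷ ps , refl , λ { (here refl) → r ; (there p∈) → good p∈ }

-- Numerical bounds

pairBound : ℕ → ℕ → ℕ
pairBound h k = suc k * suc ((suc h + suc h) + (suc h + suc h))

-- The outer `suc h` is the loss in passing from `excess` to two-paths. Inside, the clique consists
-- of `suc k + suc k` endpoints and `suc k` middles for each of `suc k * suc k` choices of start and
-- end; every member excludes at most `suc h` vertices.
linkBound : ℕ → ℕ → ℕ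
linkBound h k = suc h + suc (((suc k + suc k) + (suc k * suc k) * suc k) * suc h)

hubBound : ℕ → ℕ → ℕ
hubBound h zero    = 1
hubBound h (suc d) = suc (d + (suc h + hubBound h d))

-- A hub needs `t` out-neighbours that may lie outside the out-neighbourhood of `x`, and enough
-- others for a greedy clique of size `t + k`.
twinBound : ℕ → ℕ → ℕ → ℕ
twinBound h k t = hubBound h (t + (t + k) * suc (suc h))

-- The argument of `twinBound` is three times `linkBound`: once for a small `excess`, twice for the
-- spread of out-degrees in the window.
windowBound : ℕ → ℕ → ℕ
windowBound h k = pairBound h k * suc (twinBound h k (linkBound h k + (linkBound h k + linkBound h k)))

lowBound : ℕ → ℕ → ℕ
lowBound h k = pairBound h k * suc (pairBound h k)

bound : ℕ → ℕ → ℕ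
bound h k = windowBound h k + (pairBound h k + lowBound h k)

-- Adjacency and clashes in a digraph

module _ (G : Digraph) where

  private
    V : Set
    V = Fin (n G)

  infix 4 _⟶_ _⟶?_

  _⟶_ : V → V → Set
  u ⟶ v = E G u v ≡ true

  _⟶?_ : Decidable₂ _⟶_
  u ⟶? v = E G u v Bool.≟ true

  -- Reflexive because there are no loops: a clash-free list is duplicate-free.
  Clash : V → V → Set
  Clash u v = ¬ (u ⟶ v) × ¬ (v ⟶ u)

  clash? : Decidable₂ Clash
  clash? u v = ¬? (u ⟶? v) ×-dec ¬? (v ⟶? u)

  clash-sym : ∀ {u v} → Clash u v → Clash v u
  clash-sym (a , b) = b , a

  clash-refl : ∀ {u} → Clash u u
  clash-refl {u} = irrefl , irrefl
    where
    irrefl : ¬ (u ⟶ u)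
    irrefl e with () ← trans (sym e) (noLoop G u)

  ¬clash⇒≢ : ∀ {u v} → ¬ Clash u v → u ≢ v
  ¬clash⇒≢ ¬c refl = ¬c clash-refl

  -- Induced subgraphs and obstructions to small pathwidth

  induced : List V → Digraph
  induced L = record
    { n = length L
    ; E = λ a b → E G (lookup L a) (lookup L b)
    ; noLoop = λ a → noLoop G (lookup L a)
    }

  -- The alternative `x ≡ y` is forced by the reflexivity of `Clash`; it also lets the list repeat
  -- vertices.
  Clique : List V → Set
  Clique L = ∀ {x y} → x ∈ L → y ∈ L → x ≡ y ⊎ ¬ Clash x y

  clashFree⇒clique : ∀ {L} → AllPairs (λ x y → ¬ Clash x y) L → Clique L
  clashFree⇒clique sep x∈ y∈ with ∈-AllPairs₂ sep x∈ y∈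
  ... | inj₁ eq        = inj₁ eq
  ... | inj₂ (inj₁ ¬c) = inj₂ ¬c
  ... | inj₂ (inj₂ ¬c) = inj₂ (¬c ∘ clash-sym)

  induced-semicomplete : ∀ {L} → Unique L → Clique L → Semicomplete (induced L)
  induced-semicomplete {L} uL cl a = ≤-reflexive (countB-false _ adjacent)
    where
    adjacent : ∀ b → nonNeighbour (induced L) a b ≡ false
    adjacent b with b Fin.≟ a
    ... | yes _ = refl
    ... | no b≢a with cl (∈-lookup {xs = L} b) (∈-lookup {xs = L} a)
    ...   | inj₁ eq = contradiction (lookup-injective uL eq) b≢a
    ...   | inj₂ ¬c with E G (lookup L b) (lookup L a) | E G (lookup L a) (lookup L b)
    ...     | true  | _     = refl
    ...     | false | true  = refl
    ...     | false | false = contradiction ((λ ()) , (λ ())) ¬c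

  SemicompleteSubgraph : ℕ → Set
  SemicompleteSubgraph k = ∃[ H ] (IsSubgraph H G × Semicomplete H × PathwidthAtLeast H k)

  induced-subgraph : ∀ {L k} → Unique L → Clique L → PathwidthAtLeast (induced L) k → SemicompleteSubgraph k
  induced-subgraph {L} uL cl pw =
    induced L , (lookup L , lookup-injective uL , λ _ _ e → e) , induced-semicomplete uL cl , pw

  module Bags {L : List V} (uL : Unique L) (D : PathDecomposition (induced L)) where

    -- Passes from positions in `L`, which are the vertices of `induced L`, to vertices of `G`.
    Bag : Fin (m D) → V → Set
    Bag i v = ∃[ a ] (lookup L a ≡ v × a ∈ˢ X D i)

    bag? : ∀ i v → Dec (Bag i v)
    bag? i v = Fin.any? λ a → (lookup L a Fin.≟ v) ×-dec (a ∈ˢ? X D i)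

    lookup-index : ∀ {v} (v∈ : v ∈ L) → lookup L (Any.index v∈) ≡ v
    lookup-index v∈ = sym (Any.lookup-index v∈)

    bag-cover : ∀ {v} → v ∈ L → ∃[ i ] Bag i v
    bag-cover v∈ with i , a∈ ← cover D (Any.index v∈) = i , Any.index v∈ , lookup-index v∈ , a∈

    bag-edge : ∀ {u v} → u ∈ L → v ∈ L → u ⟶ v → ∃[ i ] ∃[ j ] (j ≤ᶠ i × Bag i u × Bag j v)
    bag-edge u∈ v∈ e
      with i , j , j≤i , a∈ , b∈ ← edges D (Any.index u∈) (Any.index v∈)
             (trans (cong₂ (E G) (lookup-index u∈) (lookup-index v∈)) e) =
      i , j , j≤i , (_ , lookup-index u∈ , a∈) , (_ , lookup-index v∈ , b∈)

    bag-interval : ∀ {v i j l} → i ≤ᶠ j → j ≤ᶠ l → Bag i v → Bag l v → Bag j v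
    bag-interval i≤j j≤l (a , refl , a∈) (b , eq , b∈) with refl ← lookup-injective uL eq =
      a , refl , interval D a _ _ _ i≤j j≤l a∈ b∈

    bag-size : ∀ {i xs} → Unique xs → (∀ {x} → x ∈ xs → Bag i x) → length xs ≤ ∣ X D i ∣
    bag-size {i} {xs} uxs f = begin
      length xs                                    ≤⟨ unique⇒length≤ uxs xs⊆ ⟩
      length (map (lookup L) (elements (X D i)))   ≡⟨ length-map (lookup L) (elements (X D i)) ⟩
      length (elements (X D i))                    ≡⟨ length-elements (X D i) ⟩
      ∣ X D i ∣                                    ∎
      where
      open ≤-Reasoning
      xs⊆ : xs ⊆ map (lookup L) (elements (X D i))
      xs⊆ x∈ with a , refl , a∈ ← f x∈ = ∈-map⁺ (lookup L) (∈-elements⁺ a∈)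

    -- An occurrence before `r` together with the one in bag `i` would force `v` into bag `r`.
    bag-later : ∀ {r i j v} → r ≤ᶠ i → Bag i v → ¬ Bag r v → Bag j v → r ≤ᶠ j
    bag-later {r} {i} {j} r≤i bi ¬br bj with Fin.≤-total j r
    ... | inj₁ j≤r = contradiction (bag-interval j≤r r≤i bj bi) ¬br
    ... | inj₂ r≤j = r≤j

    -- The edge puts `v` into a bag no later than some bag of `u`, hence no later than `r`; bag `i`
    -- lies on the other side, and the interval property applies.
    bag-successor : ∀ {r i u v} → u ∈ L → v ∈ L → u ⟶ v → (∀ i → Bag i u → i ≤ᶠ r) → r ≤ᶠ i → Bag i v → Bag r v
    bag-successor u∈ v∈ e max r≤i bi with i′ , j , j≤i′ , bu , bv ← bag-edge u∈ v∈ e =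
      bag-interval (≤-trans j≤i′ (max i′ bu)) r≤i bv bi

    bag-predecessor : ∀ {r : Fin (m D)} {u v} → u ∈ L → v ∈ L → u ⟶ v → (∀ {j} → Bag j v → r ≤ᶠ j) → ∃[ i ] (r ≤ᶠ i × Bag i u)
    bag-predecessor u∈ v∈ e late with i , j , j≤i , bu , bv ← bag-edge u∈ v∈ e =
      i , ≤-trans (late bv) j≤i , bu

  -- A vertex whose last bag comes first shares that bag with all its out-neighbours.
  minOutdegree⇒pathwidth : ∀ {L k} → Unique L → 0 < length L →
    (∀ {u} → u ∈ L → k ≤ count (u ⟶?_) L) → PathwidthAtLeast (induced L) k
  minOutdegree⇒pathwidth {y ∷ ys} {k} uL _ deg D
    with r , z , z∈ , bz , max , ends ← earliestEnd (Bags.bag? uL D) y ys (Bags.bag-cover uL D) =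
    r , ≤-trans (s≤s (deg z∈)) (bag-size uzs inside-r)
    where
    open Bags uL D
    L = y ∷ ys
    -- Width is bag size minus one, and `z` itself pays for that one.
    zs = z ∷ filter (z ⟶?_) L
    uzs : Unique zs
    uzs = All.tabulate (λ {w} w∈ → λ { refl → proj₁ clash-refl (proj₂ (∈-filter⁻ (z ⟶?_) {xs = L} w∈)) })
          ∷ Unique.filter⁺ (z ⟶?_) uL
    inside-r : ∀ {x} → x ∈ zs → Bag r x
    inside-r (here refl) = bz
    inside-r (there x∈) with x∈L , e ← ∈-filter⁻ (z ⟶?_) {xs = L} x∈
      with i , r≤i , bi ← ends x∈L =
      bag-successor {r} {i} z∈ x∈L e max r≤i bi

  -- Pairs of vertices joined by two-paths

  PairClash : V × V → V × V → Set
  PairClash (u , v) (u′ , v′) = (Clash u u′ ⊎ Clash u v′) ⊎ (Clash v u′ ⊎ Clash v v′)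

  pairClash? : Decidable₂ PairClash
  pairClash? (u , v) (u′ , v′) = (clash? u u′ ⊎-dec clash? u v′) ⊎-dec (clash? v u′ ⊎-dec clash? v v′)

  TwoPath : V → V → V → Set
  TwoPath a b w = a ⟶ w × w ⟶ b

  twoPath? : ∀ a b → Decidable (TwoPath a b)
  twoPath? a b w = (a ⟶? w) ×-dec (w ⟶? b)

  -- Equality is an alternative because pairs `(y , y)` occur too: `excess y y` is zero, so it
  -- yields no two-paths from `y` to `y`.
  Linked : ℕ → List V → V → V → Set
  Linked k L a b = a ≡ b ⊎ ∃[ ys ] (k < length ys × Unique ys × ys ⊆ L × (∀ {y} → y ∈ ys → TwoPath a b y))

  Linked-⊆ : ∀ {k L L′ a b} → L ⊆ L′ → Linked k L a b → Linked k L′ a b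
  Linked-⊆ L⊆ (inj₁ eq) = inj₁ eq
  Linked-⊆ L⊆ (inj₂ (ys , long , uys , ys⊆ , via)) = inj₂ (ys , long , uys , L⊆ ∘ ys⊆ , via)

  -- If neither u nor v of some pair lies in the earliest last bag r of the second components, then v,
  -- and hence u, occurs only after r, so bag r contains the middles of all two-paths into u.
  linkedPairs⇒pathwidth : ∀ {L k qs} → Unique L → k < length qs →
    (∀ {u v} → (u , v) ∈ qs → u ∈ L × v ∈ L × (u ≡ v ⊎ u ⟶ v)) →
    AllPairs (λ p q → ¬ PairClash p q) qs →
    (∀ {p q} → p ∈ qs → q ∈ qs → Linked k L (proj₂ p) (proj₁ q)) →
    PathwidthAtLeast (induced L) k
  linkedPairs⇒pathwidth {L} {k} {q₀ ∷ qs₀} uL len pairs sep link D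
    with earliestEnd (Bags.bag? uL D) (proj₂ q₀) (map proj₂ qs₀) cov
    where
    open Bags uL D
    cov : ∀ {y} → y ∈ map proj₂ (q₀ ∷ qs₀) → ∃[ i ] Bag i y
    cov y∈ with _ , p∈ , refl ← ∈-map⁻ proj₂ y∈ = bag-cover (proj₁ (proj₂ (pairs p∈)))
  ... | r , z , z∈ , bz , max , ends with ∈-map⁻ proj₂ {xs = q₀ ∷ qs₀} z∈
  ...   | p , p∈ , refl = r , [ ofChoices , id ]′ (All-⊎ qs meets)
    where
    open Bags uL D
    qs = q₀ ∷ qs₀

    Meets : V × V → Set
    Meets (u , v) = Bag r u ⊎ Bag r v

    meets : ∀ {q} → q ∈ qs → Meets q ⊎ k < ∣ X D r ∣
    meets {u , v} q∈ with bag? r u | bag? r v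
    ... | yes bu | _      = inj₁ (inj₁ bu)
    ... | no _   | yes bv = inj₁ (inj₂ bv)
    ... | no ¬bu | no ¬bv with pairs p∈ | pairs q∈ | ends (∈-map⁺ proj₂ q∈) | link p∈ q∈
    -- Here `u` is the second component of `p`, which does lie in bag `r`.
    ...   | _ | _ | _ | inj₁ refl = contradiction bz ¬bu
    ...   | _ , z∈L , _ | u∈ , v∈ , u↝v | i , r≤i , bi | inj₂ (ys , long , uys , ys⊆ , via) =
            inj₂ (≤-trans long (bag-size uys inside-r))
      where
      u-later : (u ≡ v ⊎ u ⟶ v) → ∃[ i ] (r ≤ᶠ i × Bag i u)
      u-later (inj₁ refl) = i , r≤i , bi
      u-later (inj₂ e)    = bag-predecessor {r} u∈ v∈ e (λ {j′} → bag-later {r} {i} {j′} r≤i bi ¬bv)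
      inside-r : ∀ {y} → y ∈ ys → Bag r y
      inside-r y∈ =
        -- All bags of `u` come after `r`, so the edge into `u` gives `y` a bag from `r` on. The
        -- edge from the vertex ending at `r` gives `y` a bag up to `r`.
        let z⟶y , y⟶u      = via y∈
            j , r≤j , bj    = u-later u↝v
            i′ , r≤i′ , bi′ = bag-predecessor {r} (ys⊆ y∈) u∈ y⟶u (λ {j′} → bag-later {r} {j} {j′} r≤j bj ¬bu)
        in bag-successor {r} {i′} z∈L (ys⊆ y∈) z⟶y max r≤i′ bi′

    -- One vertex of each pair in bag `r`. Choices from different pairs differ, since the pairs do
    -- not clash and `Clash` is reflexive.
    choice : ∀ {q} → Meets q → V
    choice {u , v} = [ (λ _ → u) , (λ _ → v) ]′

    choice-bag : ∀ {q} (c : Meets q) → Bag r (choice c)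
    choice-bag (inj₁ b) = b
    choice-bag (inj₂ b) = b

    choice-≢ : ∀ {q q′} (c : Meets q) (c′ : Meets q′) → ¬ PairClash q q′ → choice c ≢ choice c′
    choice-≢ (inj₁ _) (inj₁ _) ¬c = ¬clash⇒≢ (¬c ∘ inj₁ ∘ inj₁)
    choice-≢ (inj₁ _) (inj₂ _) ¬c = ¬clash⇒≢ (¬c ∘ inj₁ ∘ inj₂)
    choice-≢ (inj₂ _) (inj₁ _) ¬c = ¬clash⇒≢ (¬c ∘ inj₂ ∘ inj₁)
    choice-≢ (inj₂ _) (inj₂ _) ¬c = ¬clash⇒≢ (¬c ∘ inj₂ ∘ inj₂)

    choices : ∀ {qs} → All Meets qs → List V
    choices = All.reduce choice

    choices-≢ : ∀ {q qs} (c : Meets q) (cs : All Meets qs) → All (λ q′ → ¬ PairClash q q′) qs →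
                All (choice c ≢_) (choices cs)
    choices-≢ c []        []       = []
    choices-≢ c (c′ ∷ cs) (s ∷ ss) = choice-≢ c c′ s ∷ choices-≢ c cs ss

    choices-unique : ∀ {qs} (cs : All Meets qs) → AllPairs (λ p q → ¬ PairClash p q) qs → Unique (choices cs)
    choices-unique []       []       = []
    choices-unique (c ∷ cs) (s ∷ ss) = choices-≢ c cs s ∷ choices-unique cs ss

    choices-bag : ∀ {qs} (cs : All Meets qs) {x} → x ∈ choices cs → Bag r x
    choices-bag (c ∷ cs) (here refl) = choice-bag c
    choices-bag (c ∷ cs) (there x∈)  = choices-bag cs x∈

    length-choices : ∀ {qs} (cs : All Meets qs) → length (choices cs) ≡ length qs
    length-choices []       = refl
    length-choices (c ∷ cs) = cong suc (length-choices cs)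

    ofChoices : All Meets qs → k < ∣ X D r ∣
    ofChoices cs = ≤-trans (subst (k <_) (sym (length-choices cs)) len)
                           (bag-size (choices-unique cs sep) (choices-bag cs))

  -- Out-degrees and differences of out-neighbourhoods

  outdegree : V → ℕ
  outdegree v = count (v ⟶?_) (allFin (n G))

  excess? : ∀ x y → Decidable (λ w → x ⟶ w × ¬ (y ⟶ w))
  excess? x y w = (x ⟶? w) ×-dec ¬? (y ⟶? w)

  excess : V → V → ℕ
  excess x y = count (excess? x y) (allFin (n G))

  -- One small difference makes vertices near, so vertices that are not near differ by at least `t`
  -- in both directions, as `tangle⇒subgraph` will ask.
  near? : ∀ t → Decidable₂ (λ x y → excess x y < t ⊎ excess y x < t)
  near? t x y = (excess x y <? t) ⊎-dec (excess y x <? t)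

  -- Turns a gap between out-degrees into a lower bound on one `excess`; for similar out-degrees it
  -- bounds one `excess` by the other.
  excess+outdegree : ∀ x y → excess x y + outdegree y ≡ excess y x + outdegree x
  excess+outdegree x y = count-difference (x ⟶?_) (y ⟶?_) (allFin (n G))

  excess-refl : ∀ x → excess x x ≡ 0
  excess-refl x with filter (excess? x x) (allFin (n G)) in eq
  ... | []     = refl
  ... | w ∷ ws with _ , e , ¬e ← ∈-filter⁻ (excess? x x) {xs = allFin (n G)} (subst (w ∈_) (sym eq) (here refl)) =
        contradiction e ¬e

  -- Consequences of having few non-neighbours

  module _ {h : ℕ} (sc : SemicompleteH h G) where

    -- Reflexivity adds `v` itself to its at most `h` non-neighbours.
    count-clash : ∀ v {xs} → Unique xs → count (clash? v) xs ≤ suc h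
    count-clash v {xs} uxs = begin
      count (clash? v) xs                        ≤⟨ count-cover (clash? v) (v Fin.≟_) nonNb? xs (λ {u} _ → split {u}) ⟩
      count (v Fin.≟_) xs + count nonNb? xs      ≤⟨ +-mono-≤ only-v few ⟩
      suc h                                      ∎
      where
      open ≤-Reasoning
      nonNb? : Decidable (λ u → nonNeighbour G v u ≡ true)
      nonNb? u = nonNeighbour G v u Bool.≟ true
      split : ∀ {u} → Clash v u → v ≡ u ⊎ nonNeighbour G v u ≡ true
      split {u} (a , b) with u Fin.≟ v
      ... | yes eq = inj₁ (sym eq)
      ... | no _ with E G u v | E G v u
      ...   | true  | _     = contradiction refl b
      ...   | false | true  = contradiction refl a
      ...   | false | false = inj₂ refl
      only-v : count (v Fin.≟_) xs ≤ 1
      only-v = unique⇒length≤ {ys = v ∷ []} (Unique.filter⁺ (v Fin.≟_) uxs)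
                 (λ x∈ → here (sym (proj₂ (∈-filter⁻ (v Fin.≟_) {xs = xs} x∈))))
      few : count nonNb? xs ≤ h
      few = ≤-trans (unique⇒length≤countB (nonNeighbour G v) (Unique.filter⁺ nonNb? uxs)
                       (λ x∈ → proj₂ (∈-filter⁻ nonNb? {xs = xs} x∈)))
                    (sc v)

    -- Growing cliques

    -- Each member of `M` excludes at most `suc h` vertices of `ws`.
    pick : ∀ M {ws} → Unique ws → length M * suc h < length ws → ∃[ w ] (w ∈ ws × All (λ x → ¬ Clash x w) M)
    pick []      {w ∷ ws} uws _ = w , here refl , []
    pick (x ∷ M) {ws} uws len =
      let w , w∈ , free = pick M (Unique.filter⁺ compatible? uws) enough
          w∈ws , ¬c = ∈-filter⁻ compatible? {xs = ws} w∈
      in w , w∈ws , ¬c ∷ free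
      where
      compatible? : Decidable (λ w → ¬ Clash x w)
      compatible? w = ¬? (clash? x w)
      enough : length M * suc h < count compatible? ws
      enough = +-cancelˡ-≤ (suc h) _ _ (begin
        suc h + suc (length M * suc h)                ≡⟨ +-suc (suc h) _ ⟩
        suc (suc h + length M * suc h)                ≤⟨ len ⟩
        length ws                                     ≤⟨ length-cover (clash? x) compatible? ws (λ {w} _ → decide (clash? x w)) ⟩
        count (clash? x) ws + count compatible? ws    ≤⟨ +-monoˡ-≤ _ (count-clash x uws) ⟩
        suc h + count compatible? ws                  ∎)
        where open ≤-Reasoning

    extendClique : ∀ a {L ws} → Clique L → Unique ws → (length L + a) * suc h < length ws →
                   ∃[ ys ] (length ys ≡ a × Unique ys × ys ⊆ ws × Clique (ys ++ L))
    extendClique zero cl uws len = [] , refl , [] , (λ ()) , cl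
    extendClique (suc a) {L} {ws} cl uws len
      with ys , refl , uys , ys⊆ , cl′ ← extendClique a cl uws
             (≤-trans (s≤s (*-monoˡ-≤ (suc h) (+-monoʳ-≤ (length L) (n≤1+n a)))) len)
      with w , w∈ , free ← pick (ys ++ L) uws (≤-trans (s≤s (*-monoˡ-≤ (suc h) (≤-trans (≤-reflexive (length-++-comm ys L)) (+-monoʳ-≤ (length L) (n≤1+n (length ys)))))) len) =
      w ∷ ys , refl ,
      All.tabulate (λ y∈ eq → ¬clash⇒≢ (All.lookup free (∈-++⁺ˡ y∈)) (sym eq)) ∷ uys ,
      (λ { (here refl) → w∈ ; (there y∈) → ys⊆ y∈ }) ,
      λ { (here refl) (here refl) → inj₁ refl
        ; (here refl) (there y∈)  → inj₂ (All.lookup free y∈ ∘ clash-sym)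
        ; (there x∈)  (here refl) → inj₂ (All.lookup free x∈)
        ; (there x∈)  (there y∈)  → cl′ x∈ y∈ }

    -- The pairs of `ts` receive their `suc k` middles in turn, each chosen to keep the list a
    -- clique. Whatever joins `L` leaves `length ts * suc k`, so the bound on `t` survives every
    -- round.
    linkAll : ∀ k t (ts : List (V × V)) {L} → Clique L →
              (∀ {a b} → (a , b) ∈ ts → a ≡ b ⊎ t ≤ count (twoPath? a b) (allFin (n G))) →
              (length L + length ts * suc k) * suc h < t →
              ∃[ L′ ] (L ⊆ L′ × Clique L′ × (∀ {a b} → (a , b) ∈ ts → Linked k L′ a b))
    linkAll k t [] {L} cl _ _ = L , id , cl , λ ()
    linkAll k t ((a , b) ∷ ts) {L} cl enough bound with enough (here refl)
    ... | inj₁ refl =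
          let L′ , L⊆ , cl′ , linked = linkAll k t ts cl (enough ∘ there)
                (≤-trans (s≤s (*-monoˡ-≤ (suc h) (+-monoʳ-≤ (length L) (m≤n+m (length ts * suc k) (suc k))))) bound)
          in L′ , L⊆ , cl′ , λ { (here refl) → inj₁ refl ; (there t∈) → linked t∈ }
    ... | inj₂ many
      with ys , len-ys , uys , ys⊆ , cl₁ ← extendClique (suc k) {L} {filter (twoPath? a b) (allFin (n G))} cl
             (Unique.filter⁺ (twoPath? a b) (Unique.allFin⁺ (n G)))
             (≤-trans (s≤s (*-monoˡ-≤ (suc h) (+-monoʳ-≤ (length L) (m≤m+n (suc k) (length ts * suc k)))))
                      (≤-trans bound many))
      with L′ , L⊆ , cl′ , linked ← linkAll k t ts cl₁ (enough ∘ there)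
             (subst (λ z → z * suc h < t) (sym (trans (cong (_+ length ts * suc k) (trans (length-++-comm ys L) (cong (length L +_) len-ys)))
                                               (+-assoc (length L) (suc k) (length ts * suc k)))) bound) =
      L′ , L⊆ ∘ ∈-++⁺ʳ ys , cl′ ,
      λ { (here refl) → inj₂ (ys , ≤-reflexive (sym len-ys) , uys , L⊆ ∘ ∈-++⁺ˡ ,
                              λ y∈ → proj₂ (∈-filter⁻ (twoPath? a b) {xs = allFin (n G)} (ys⊆ y∈)))
        ; (there t∈) → linked t∈ }

    -- A vertex that is not an out-neighbour of `b` either clashes with `b` or points to it.
    excess≤twoPaths : ∀ a b → excess a b ≤ suc h + count (twoPath? a b) (allFin (n G))
    excess≤twoPaths a b = ≤-trans
      (count-cover (excess? a b) (clash? b) (twoPath? a b) (allFin (n G)) (λ {w} _ → split {w}))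
      (+-monoˡ-≤ _ (count-clash b (Unique.allFin⁺ (n G))))
      where
      split : ∀ {w} → (a ⟶ w × ¬ (b ⟶ w)) → Clash b w ⊎ TwoPath a b w
      split {w} (e , ¬e) with w ⟶? b
      ... | yes e′ = inj₂ (e , e′)
      ... | no ¬e′ = inj₁ (¬e , ¬e′)

    -- From many pairs to a semicomplete subgraph

    count-pairClash : ∀ {ps} p → Unique (map proj₁ ps) → Unique (map proj₂ ps) →
                      count (pairClash? p) ps ≤ (suc h + suc h) + (suc h + suc h)
    count-pairClash {ps} (u , v) u₁ u₂ = begin
      count (pairClash? (u , v)) ps  ≤⟨ count-cover (pairClash? (u , v)) (either? u) (either? v) ps (λ _ → id) ⟩
      count (either? u) ps + count (either? v) ps  ≤⟨ +-mono-≤ (few u) (few v) ⟩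
      (suc h + suc h) + (suc h + suc h)  ∎
      where
      open ≤-Reasoning
      either? : ∀ x → Decidable (λ (q : V × V) → Clash x (proj₁ q) ⊎ Clash x (proj₂ q))
      either? x q = clash? x (proj₁ q) ⊎-dec clash? x (proj₂ q)
      few : ∀ x → count (either? x) ps ≤ suc h + suc h
      few x = begin
        count (either? x) ps
          ≤⟨ count-cover (either? x) (λ q → clash? x (proj₁ q)) (λ q → clash? x (proj₂ q)) ps (λ _ → id) ⟩
        count (λ q → clash? x (proj₁ q)) ps + count (λ q → clash? x (proj₂ q)) ps
          ≡⟨ cong₂ _+_ (count-map (clash? x) proj₁ ps) (count-map (clash? x) proj₂ ps) ⟩
        count (clash? x) (map proj₁ ps) + count (clash? x) (map proj₂ ps)
          ≤⟨ +-mono-≤ (count-clash x u₁) (count-clash x u₂) ⟩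
        suc h + suc h  ∎

    -- Pairs free of clashes have endpoints forming a clique. A large `excess` supplies two-paths
    -- between them, and adding middles to the clique leads to `linkedPairs⇒pathwidth`.
    tangle⇒subgraph : ∀ k {ps} → pairBound h k ≤ length ps →
      Unique (map proj₁ ps) → Unique (map proj₂ ps) →
      (∀ {u v} → (u , v) ∈ ps → u ≡ v ⊎ u ⟶ v) →
      (∀ {p q} → p ∈ ps → q ∈ ps → proj₂ p ≡ proj₁ q ⊎ linkBound h k ≤ excess (proj₂ p) (proj₁ q)) →
      SemicompleteSubgraph k
    tangle⇒subgraph k {ps} len u₁ u₂ inner far
      -- Either vertex of a pair clashes with at most `suc h` first and `suc h` second components,
      -- which gives the four summands.
      with greedy pairClash? ((suc h + suc h) + (suc h + suc h)) (suc k) ps len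
    ... | inj₁ (p , _ , many) = contradiction (count-pairClash p u₁ u₂) (<⇒≱ many)
    ... | inj₂ (qs , qs⊆ , len-qs , sep) = build (linkAll k _ ts clique₀ paths ≤-refl)
      where
      us = map proj₁ qs
      vs = map proj₂ qs
      L₀ = us ++ vs
      ts = cartesianProduct vs us

      len-us : length us ≡ suc k
      len-us = trans (length-map proj₁ qs) len-qs
      len-vs : length vs ≡ suc k
      len-vs = trans (length-map proj₂ qs) len-qs

      linkBound≡ : linkBound h k ≡ suc h + suc ((length L₀ + length ts * suc k) * suc h)
      linkBound≡ = cong (λ z → suc h + suc (z * suc h)) (sym (cong₂ (λ a b → a + b * suc k)
        (trans (length-++ us) (cong₂ _+_ len-us len-vs))
        (trans (length-cartesianProduct vs us) (cong₂ _*_ len-vs len-us))))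

      Part : V → V × V → Set
      Part x q = x ≡ proj₁ q ⊎ x ≡ proj₂ q

      part : ∀ {x} → x ∈ L₀ → ∃[ q ] (q ∈ qs × Part x q)
      part x∈ with ∈-++⁻ us x∈
      ... | inj₁ x∈us = let q , q∈ , eq = ∈-map⁻ proj₁ x∈us in q , q∈ , inj₁ eq
      ... | inj₂ x∈vs = let q , q∈ , eq = ∈-map⁻ proj₂ x∈vs in q , q∈ , inj₂ eq

      across : ∀ {x y p q} → Part x p → Part y q → ¬ PairClash p q → ¬ Clash x y
      across (inj₁ refl) (inj₁ refl) ¬c = ¬c ∘ inj₁ ∘ inj₁
      across (inj₁ refl) (inj₂ refl) ¬c = ¬c ∘ inj₁ ∘ inj₂
      across (inj₂ refl) (inj₁ refl) ¬c = ¬c ∘ inj₂ ∘ inj₁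
      across (inj₂ refl) (inj₂ refl) ¬c = ¬c ∘ inj₂ ∘ inj₂

      adjacent : ∀ {u v} → u ≡ v ⊎ u ⟶ v → u ≡ v ⊎ ¬ Clash u v
      adjacent = map-⊎ id (λ e c → proj₁ c e)

      within : ∀ {x y q} → q ∈ qs → Part x q → Part y q → x ≡ y ⊎ ¬ Clash x y
      within q∈ (inj₁ refl) (inj₁ refl) = inj₁ refl
      within q∈ (inj₁ refl) (inj₂ refl) = adjacent (inner (qs⊆ q∈))
      within q∈ (inj₂ refl) (inj₁ refl) = map-⊎ sym (_∘ clash-sym) (adjacent (inner (qs⊆ q∈)))
      within q∈ (inj₂ refl) (inj₂ refl) = inj₁ refl

      clique₀ : Clique L₀
      clique₀ x∈ y∈ with part x∈ | part y∈
      ... | p , p∈ , xp | q , q∈ , yq with ∈-AllPairs₂ sep p∈ q∈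
      ...   | inj₁ refl      = within p∈ xp yq
      ...   | inj₂ (inj₁ ¬c) = inj₂ (across xp yq ¬c)
      ...   | inj₂ (inj₂ ¬c) = inj₂ (across yq xp ¬c ∘ clash-sym)

      paths : ∀ {a b} → (a , b) ∈ ts →
              a ≡ b ⊎ suc ((length L₀ + length ts * suc k) * suc h) ≤ count (twoPath? a b) (allFin (n G))
      paths t∈ with ∈-cartesianProduct⁻ vs us t∈
      ... | a∈ , b∈ with ∈-map⁻ proj₂ a∈ | ∈-map⁻ proj₁ b∈
      ...   | p , p∈ , refl | q , q∈ , refl with far (qs⊆ p∈) (qs⊆ q∈)
      ...     | inj₁ eq = inj₁ eq
      ...     | inj₂ big = inj₂ (+-cancelˡ-≤ (suc h) _ _
                  (≤-trans (≤-reflexive (sym linkBound≡)) (≤-trans big (excess≤twoPaths (proj₂ p) (proj₁ q)))))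

      build : ∃[ L ] (L₀ ⊆ L × Clique L × (∀ {a b} → (a , b) ∈ ts → Linked k L a b)) → SemicompleteSubgraph k
      build (L , L₀⊆ , cl , linked) =
        -- A pair `(y , y)` contributes `y` twice to `L₀`, hence the removal of duplicates.
        induced-subgraph (deduplicate-! Fin._≟_ L) (λ x∈ y∈ → cl (∈-deduplicate⁻ Fin._≟_ L x∈) (∈-deduplicate⁻ Fin._≟_ L y∈))
          (linkedPairs⇒pathwidth {qs = qs} (deduplicate-! Fin._≟_ L) (≤-reflexive (sym len-qs))
            (λ q∈ → L⊆ (L₀⊆ (∈-++⁺ˡ (∈-map⁺ proj₁ q∈))) ,
                    L⊆ (L₀⊆ (∈-++⁺ʳ us (∈-map⁺ proj₂ q∈))) ,
                    inner (qs⊆ q∈))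
            sep
            (λ p∈ q∈ → Linked-⊆ L⊆ (linked (∈-cartesianProduct⁺ (∈-map⁺ proj₂ p∈) (∈-map⁺ proj₁ q∈)))))
        where
        L⊆ : L ⊆ deduplicate Fin._≟_ L
        L⊆ = ∈-deduplicate⁺ Fin._≟_

    -- Vertices with almost equal out-neighbourhoods

    -- If the head `y` has at most `d` out-neighbours in the tail, all but at most `d + suc h`
    -- vertices there point to `y`. A vertex with `d` out-neighbours among those gains `y` as one
    -- more.
    hub : ∀ d {xs} → Unique xs → hubBound h d ≤ length xs → ∃[ x ] (x ∈ xs × d ≤ count (x ⟶?_) xs)
    hub zero    {x ∷ xs} _ _ = x , here refl , z≤n
    hub (suc d) {y ∷ ys} (y∉ ∷ uys) (s≤s len) with suc d ≤? count (y ⟶?_) ys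
    ... | yes many = y , here refl , ≤-trans many (count-∷ (y ⟶?_) y ys)
    ... | no few =
          let x , x∈ , deg = hub d (Unique.filter⁺ (_⟶? y) uys) enough
              x∈ys , x⟶y = ∈-filter⁻ (_⟶? y) {xs = ys} x∈
          in x , there x∈ys ,
             ≤-trans (s≤s (≤-trans deg (count-filter (x ⟶?_) (_⟶? y) ys)))
                     (≤-reflexive (sym (cong length (filter-accept (x ⟶?_) {xs = ys} x⟶y))))
      where
      open ≤-Reasoning
      enough : hubBound h d ≤ count (_⟶? y) ys
      enough = +-cancelˡ-≤ (suc h) _ _ (+-cancelˡ-≤ d _ _ (begin
        d + (suc h + hubBound h d)
          ≤⟨ len ⟩
        length ys
          ≤⟨ length-cover (y ⟶?_) (¬? ∘ (y ⟶?_)) ys (λ {x} _ → decide (y ⟶? x)) ⟩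
        count (y ⟶?_) ys + count (¬? ∘ (y ⟶?_)) ys
          ≤⟨ +-mono-≤ (≮⇒≥ few) (count-cover (¬? ∘ (y ⟶?_)) (clash? y) (_⟶? y) ys (λ {x} _ → split {x})) ⟩
        d + (count (clash? y) ys + count (_⟶? y) ys)
          ≤⟨ +-monoʳ-≤ d (+-monoˡ-≤ _ (count-clash y uys)) ⟩
        d + (suc h + count (_⟶? y) ys)  ∎))
        where
        split : ∀ {x} → ¬ (y ⟶ x) → Clash y x ⊎ x ⟶ y
        split {x} ¬e with x ⟶? y
        ... | yes e  = inj₂ e
        ... | no ¬e′ = inj₁ (¬e , ¬e′)

    -- Among the vertices resembling x, those in the out-neighbourhood of x miss few of one another.
    twins⇒subgraph : ∀ k t x {ys} → 0 < k → Unique ys → twinBound h k t ≤ length ys →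
      (∀ {y} → y ∈ ys → excess x y ≤ t × excess y x ≤ t) → SemicompleteSubgraph k
    twins⇒subgraph k t x {ys} 0<k uys len near with hub (t + (t + k) * suc (suc h)) uys len
    ... | y , y∈ , deg = build (greedy clash? (suc h) (t + k) A enough)
      where
      open ≤-Reasoning
      -- Since `excess y x ≤ t`, all but at most `t` of the out-neighbours of the hub `y` are
      -- out-neighbours of `x`.
      Z = filter (y ⟶?_) ys
      A = filter (x ⟶?_) Z

      uA : Unique A
      uA = Unique.filter⁺ (x ⟶?_) (Unique.filter⁺ (y ⟶?_) uys)

      enough : (t + k) * suc (suc h) ≤ length A
      enough = +-cancelˡ-≤ t _ _ (begin
        t + (t + k) * suc (suc h)          ≤⟨ deg ⟩
        length Z                           ≤⟨ length-cover (¬? ∘ (x ⟶?_)) (x ⟶?_) Z (λ {z} _ → [ inj₂ , inj₁ ]′ (decide (x ⟶? z))) ⟩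
        count (¬? ∘ (x ⟶?_)) Z + length A  ≤⟨ +-monoˡ-≤ (length A) (≤-trans
                                                 (count≤count-allFin (¬? ∘ (x ⟶?_)) (excess? y x) (Unique.filter⁺ (y ⟶?_) uys)
                                                   (λ z∈ ¬e → proj₂ (∈-filter⁻ (y ⟶?_) {xs = ys} z∈) , ¬e))
                                                 (proj₂ (near y∈))) ⟩
        t + length A  ∎)

      build : (∃[ z ] (z ∈ A × suc h < count (clash? z) A)) ⊎
              (∃[ L ] (L ⊆ A × length L ≡ t + k × AllPairs (λ u v → ¬ Clash u v) L)) → SemicompleteSubgraph k
      build (inj₁ (z , _ , many)) = contradiction (count-clash z uA) (<⇒≱ many)
      build (inj₂ (L , L⊆ , len-L , sep)) =
        induced-subgraph uL (clashFree⇒clique sep)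
          (minOutdegree⇒pathwidth uL (≤-trans 0<k (≤-trans (m≤n+m k t) (≤-reflexive (sym len-L)))) outdeg)
        where
        uL : Unique L
        uL = AllPairs.map ¬clash⇒≢ sep
        outdeg : ∀ {u} → u ∈ L → k ≤ count (u ⟶?_) L
        -- The vertices missed by `u` include `u` itself, so size `t + k` suffices for out-degree
        -- `k`.
        outdeg {u} u∈ = +-cancelˡ-≤ t _ _ (begin
          t + k
            ≡⟨ len-L ⟨
          length L
            ≤⟨ length-cover (¬? ∘ (u ⟶?_)) (u ⟶?_) L (λ {z} _ → [ inj₂ , inj₁ ]′ (decide (u ⟶? z))) ⟩
          count (¬? ∘ (u ⟶?_)) L + count (u ⟶?_) L
            ≤⟨ +-monoˡ-≤ _ (count≤count-allFin (¬? ∘ (u ⟶?_)) (excess? x u) uL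
                 (λ z∈ ¬e → proj₂ (∈-filter⁻ (x ⟶?_) {xs = Z} (L⊆ z∈)) , ¬e)) ⟩
          excess x u + count (u ⟶?_) L
            ≤⟨ +-monoˡ-≤ _ (proj₁ (near (proj₁ (∈-filter⁻ (y ⟶?_) {xs = ys} (proj₁ (∈-filter⁻ (x ⟶?_) {xs = Z} (L⊆ u∈))))))) ⟩
          t + count (u ⟶?_) L  ∎)

    -- Similar out-degrees, and matchings across a gap

    window⇒subgraph : ∀ k c {xs} → 0 < k → Unique xs → windowBound h k ≤ length xs →
      (∀ {x} → x ∈ xs → c ≤ outdegree x + linkBound h k × outdegree x ≤ c + linkBound h k) →
      SemicompleteSubgraph k
    window⇒subgraph k c {xs} 0<k uxs len win
      -- Either some `x` has many vertices near it, which are treated as its twins, or many vertices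
      -- are pairwise far apart, and each is paired with itself.
      with greedy (near? (linkBound h k)) (twinBound h k (linkBound h k + (linkBound h k + linkBound h k))) (pairBound h k) xs len
    ... | inj₁ (x , x∈ , many) =
          twins⇒subgraph k (T + (T + T)) x 0<k (Unique.filter⁺ (near? T x) uxs) (<⇒≤ many) near
      where
      T = linkBound h k
      -- The two differences are as far apart as the out-degrees, which differ by at most `T + T`
      -- inside the window.
      transfer : ∀ {u v} → u ∈ xs → v ∈ xs → excess u v < T → excess v u ≤ T + (T + T)
      transfer {u} {v} u∈ v∈ small = +-cancelʳ-≤ (outdegree u) _ _ (begin
        excess v u + outdegree u        ≡⟨ excess+outdegree v u ⟩
        excess u v + outdegree v        ≤⟨ +-mono-≤ (<⇒≤ small) (proj₂ (win v∈)) ⟩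
        T + (c + T)                     ≤⟨ +-monoʳ-≤ T (+-monoˡ-≤ T (proj₁ (win u∈))) ⟩
        T + ((outdegree u + T) + T)     ≡⟨ cong (T +_) (trans (+-assoc (outdegree u) T T) (+-comm (outdegree u) (T + T))) ⟩
        T + ((T + T) + outdegree u)     ≡⟨ +-assoc T (T + T) (outdegree u) ⟨
        (T + (T + T)) + outdegree u     ∎)
        where open ≤-Reasoning
      weaken : ∀ {a} → a < T → a ≤ T + (T + T)
      weaken a<T = ≤-trans (<⇒≤ a<T) (m≤m+n T (T + T))
      near : ∀ {y} → y ∈ filter (near? T x) xs → excess x y ≤ T + (T + T) × excess y x ≤ T + (T + T)
      near y∈ with ∈-filter⁻ (near? T x) {xs = xs} y∈
      ... | y∈xs , inj₁ small = weaken small , transfer x∈ y∈xs small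
      ... | y∈xs , inj₂ small = transfer y∈xs x∈ small , weaken small
    ... | inj₂ (ys , ys⊆ , len-ys , far) =
          tangle⇒subgraph k (≤-reflexive (sym (trans (length-map diagonal ys) len-ys)))
            (AllPairs.map⁺ (AllPairs.map⁺ uys)) (AllPairs.map⁺ (AllPairs.map⁺ uys)) inner linked
      where
      diagonal : V → V × V
      diagonal y = y , y
      -- Every vertex is near itself, its `excess` over itself being zero and `linkBound h k`
      -- positive.
      uys : Unique ys
      uys = AllPairs.map (λ { {y} far refl → far (inj₁ (≤-trans (s≤s (≤-reflexive (excess-refl y))) (s≤s z≤n))) }) far
      inner : ∀ {u v} → (u , v) ∈ map diagonal ys → u ≡ v ⊎ u ⟶ v
      inner p∈ with _ , _ , refl ← ∈-map⁻ diagonal p∈ = inj₁ refl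
      linked : ∀ {p q} → p ∈ map diagonal ys → q ∈ map diagonal ys →
               proj₂ p ≡ proj₁ q ⊎ linkBound h k ≤ excess (proj₂ p) (proj₁ q)
      linked p∈ q∈ with ∈-map⁻ diagonal p∈ | ∈-map⁻ diagonal q∈
      ... | x , x∈ , refl | y , y∈ , refl with ∈-AllPairs₂ far x∈ y∈
      ...   | inj₁ eq        = inj₁ eq
      ...   | inj₂ (inj₁ ¬n) = inj₂ (≮⇒≥ (¬n ∘ inj₁))
      ...   | inj₂ (inj₂ ¬n) = inj₂ (≮⇒≥ (¬n ∘ inj₂))

    -- The `excess` of one vertex over another is at least the difference of their out-degrees, so
    -- the gap is all that `tangle⇒subgraph` needs besides the edges.
    matching⇒subgraph : ∀ k {ps} → pairBound h k ≤ length ps →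
      Unique (map proj₁ ps) → Unique (map proj₂ ps) → (∀ {u v} → (u , v) ∈ ps → u ⟶ v) →
      (∀ {p q} → p ∈ ps → q ∈ ps → outdegree (proj₁ q) + linkBound h k ≤ outdegree (proj₂ p)) →
      SemicompleteSubgraph k
    matching⇒subgraph k len u₁ u₂ edge gap = tangle⇒subgraph k len u₁ u₂ (inj₂ ∘ edge)
      λ {p} {q} p∈ q∈ → inj₂ (+-cancelʳ-≤ (outdegree (proj₁ q)) _ _ (begin
        linkBound h k + outdegree (proj₁ q)                     ≡⟨ +-comm (linkBound h k) _ ⟩
        outdegree (proj₁ q) + linkBound h k                     ≤⟨ gap p∈ q∈ ⟩
        outdegree (proj₂ p)                                     ≤⟨ m≤n+m _ (excess (proj₁ q) (proj₂ p)) ⟩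
        excess (proj₁ q) (proj₂ p) + outdegree (proj₂ p)        ≡⟨ excess+outdegree (proj₁ q) (proj₂ p) ⟩
        excess (proj₂ p) (proj₁ q) + outdegree (proj₁ q)        ∎))
      where open ≤-Reasoning

  -- A path decomposition ordered by out-degree

  earlier? : ∀ v c → Decidable (λ u → u ⟶ v × outdegree u < c)
  earlier? v c u = (u ⟶? v) ×-dec (outdegree u <? c)

  earlier : V → ℕ → ℕ
  earlier v c = count (earlier? v c) (allFin (n G))

  earlier-mono : ∀ v {c c′} → c ≤ c′ → earlier v c ≤ earlier v c′
  earlier-mono v {c} {c′} c≤c′ =
    count≤count-allFin (earlier? v c) (earlier? v c′) (Unique.allFin⁺ (n G)) (λ _ (e , lt) → e , ≤-trans lt c≤c′)

  outdegree≤n : ∀ v → outdegree v ≤ n G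
  outdegree≤n v = ≤-trans (length-filter (v ⟶?_) (allFin (n G))) (≤-reflexive (length-tabulate id))

  module DegreeDecomposition (K : ℕ) where

    -- Vertex v enters at its out-degree, or earlier, once more than K of its in-neighbours have
    -- out-degree at most c; it leaves as soon as all its out-neighbours have entered.
    Opened Unfinished InBag : ℕ → V → Set
    Opened c v     = outdegree v ≤ c ⊎ K < earlier v (suc c)
    Unfinished c v = c ≤ outdegree v ⊎ (∃[ w ] (v ⟶ w × c ≤ outdegree w × earlier w c ≤ K))
    InBag c v      = Opened c v × Unfinished c v

    inBag? : ∀ c → Decidable (InBag c)
    inBag? c v = ((outdegree v ≤? c) ⊎-dec (K <? earlier v (suc c))) ×-dec
                 ((c ≤? outdegree v) ⊎-dec
                  Fin.any? λ w → (v ⟶? w) ×-dec ((c ≤? outdegree w) ×-dec (earlier w c ≤? K)))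

    -- `Opened` persists when `c` grows, `Unfinished` when `c` shrinks.
    inBag-interval : ∀ {v a b c} → a ≤ b → b ≤ c → InBag a v → InBag c v → InBag b v
    inBag-interval {v} a≤b b≤c (opened , _) (_ , unfinished) =
      map-⊎ (λ p → ≤-trans p a≤b) (λ p → ≤-trans p (earlier-mono v (s≤s a≤b))) opened ,
      map-⊎ (≤-trans b≤c) (λ (w , e , p , q) → w , e , ≤-trans b≤c p , ≤-trans (earlier-mono w b≤c) q) unfinished

    inBag-outdegree : ∀ v → InBag (outdegree v) v
    inBag-outdegree v = inj₁ ≤-refl , inj₁ ≤-refl

    -- The index `a` rises from the out-degree of `u`. While `earlier v a ≤ K`, the vertex `v` keeps
    -- `u` unfinished; `v` opens at its out-degree or once `earlier v (suc a)` exceeds `K`. The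
    -- shift from `a` to `suc a` makes both share the bag where the count passes `K`.
    climb : ∀ {u v} gap a → a + gap ≡ outdegree v → outdegree u ≤ a → a ≤ outdegree u ⊎ earlier v a ≤ K → u ⟶ v →
            ∃[ c ] (c ≤ outdegree v × InBag c u × InBag c v)
    climb {v = v} zero a eq u≤a start e with refl ← trans (sym (+-identityʳ a)) eq =
      a , ≤-refl , (inj₁ u≤a , map-⊎ id (λ few → v , e , ≤-refl , few) start) , inBag-outdegree v
    climb {v = v} (suc gap) a eq u≤a start e with K <? earlier v (suc a)
    ... | yes many = a , a≤v , (inj₁ u≤a , map-⊎ id (λ few → v , e , a≤v , few) start) , (inj₂ many , inj₁ a≤v)
      where
      a≤v : a ≤ outdegree v
      a≤v = ≤-trans (m≤m+n a (suc gap)) (≤-reflexive eq)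
    ... | no few = climb gap (suc a) (trans (sym (+-suc a gap)) eq) (m≤n⇒m≤1+n u≤a) (inj₂ (≮⇒≥ few)) e

    inBag-edge : ∀ {u v} → u ⟶ v → ∃[ i ] ∃[ j ] (j ≤ i × i ≤ n G × InBag i u × InBag j v)
    inBag-edge {u} {v} e with ≤-total (outdegree v) (outdegree u)
    ... | inj₁ v≤u = _ , _ , v≤u , outdegree≤n u , inBag-outdegree u , inBag-outdegree v
    ... | inj₂ u≤v with m≤n⇒∃[o]m+o≡n u≤v
    ...   | gap , eq with climb gap (outdegree u) eq ≤-refl (inj₁ ≤-refl) e
    ...     | c , c≤v , bu , bv = c , c , ≤-refl , ≤-trans c≤v (outdegree≤n v) , bu , bv

    decomposition : PathDecomposition G
    decomposition = record
      { m        = suc (n G)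
      ; X        = λ i → comprehension (inBag? (toℕ i))
      ; cover    = λ v → _ , member (outdegree≤n v) (inBag-outdegree v)
      ; edges    = λ u v e → let i , j , j≤i , i≤n , bu , bv = inBag-edge e in
                     _ , _ ,
                     subst₂ _≤_ (sym (Fin.toℕ-fromℕ< (s≤s (≤-trans j≤i i≤n)))) (sym (Fin.toℕ-fromℕ< (s≤s i≤n))) j≤i ,
                     member i≤n bu , member (≤-trans j≤i i≤n) bv
      ; interval = λ v i j k i≤j j≤k v∈i v∈k → ∈-comprehension⁺ (inBag? (toℕ j))
                     (inBag-interval i≤j j≤k (∈-comprehension⁻ (inBag? (toℕ i)) v∈i) (∈-comprehension⁻ (inBag? (toℕ k)) v∈k))
      }
      where
      member : ∀ {c v} (c≤n : c ≤ n G) → InBag c v → v ∈ˢ comprehension (inBag? (toℕ (fromℕ< (s≤s c≤n))))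
      member {c} {v} c≤n b = ∈-comprehension⁺ (inBag? (toℕ (fromℕ< (s≤s c≤n))))
        (subst (λ z → InBag z v) (sym (Fin.toℕ-fromℕ< (s≤s c≤n))) b)

  -- Matchings from large bags

  greedyMatching : {Q : V → V → Set} (Q? : Decidable₂ Q) → ∀ K m {xs} → Unique xs → m ≤ length xs → m ≤ suc K →
    (∀ {x} → x ∈ xs → K < count (Q? x) (allFin (n G))) →
    ∃[ ps ] (length ps ≡ m × Unique (map proj₁ ps) × Unique (map proj₂ ps) ×
             (∀ {u x} → (u , x) ∈ ps → x ∈ xs × Q x u))
  greedyMatching Q? K zero uxs _ _ _ = [] , refl , [] , [] , λ ()
  greedyMatching Q? K (suc m) {x ∷ xs} (x∉ ∷ uxs) (s≤s len) (s≤s m≤K) many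
    with ps , len-ps , u₁ , u₂ , match ← greedyMatching Q? K m uxs len (m≤n⇒m≤1+n m≤K) (many ∘ there)
    -- At most `K` vertices are used so far, while `x` has more than `K` candidates.
    with u , u∈ , u∉ ← fresh {ws = filter (Q? x) (allFin (n G))} {map proj₁ ps}
           (Unique.filter⁺ (Q? x) (Unique.allFin⁺ (n G)))
           (≤-trans (s≤s (≤-trans (≤-reflexive (trans (length-map proj₁ ps) len-ps)) m≤K)) (many (here refl))) =
    (u , x) ∷ ps , cong suc len-ps ,
    All.tabulate (λ { y∈ refl → u∉ y∈ }) ∷ u₁ ,
    All.tabulate (λ { y∈ refl → let _ , p∈ , eq = ∈-map⁻ proj₂ y∈ in All.lookup x∉ (proj₁ (match p∈)) eq }) ∷ u₂ ,
    λ { (here refl) → here refl , proj₂ (∈-filter⁻ (Q? x) {xs = allFin (n G)} u∈)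
      ; (there p∈) → let x∈ , q = match p∈ in there x∈ , q }

  module _ {h : ℕ} (sc : SemicompleteH h G) (k : ℕ) where

    private
      T K : ℕ
      T = linkBound h k
      K = pairBound h k

    open DegreeDecomposition K

    -- These vertices entered before the index reached their out-degree, so each has more than `K`
    -- in-neighbours of out-degree at most `c`, enough to match `K` of them.
    high⇒subgraph : ∀ c {xs} → Unique xs → K ≤ length xs →
      (∀ {x} → x ∈ xs → InBag c x × c + T < outdegree x) → SemicompleteSubgraph k
    high⇒subgraph c {xs} uxs len high =
      let ps , len-ps , u₁ , u₂ , match = greedyMatching (λ x → earlier? x (suc c)) K K uxs len (n≤1+n K) many
      in matching⇒subgraph sc k (≤-reflexive (sym len-ps)) u₁ u₂ (λ p∈ → proj₁ (proj₂ (match p∈)))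
           λ p∈ q∈ → ≤-trans (+-monoˡ-≤ T (≤-pred (proj₂ (proj₂ (match q∈))))) (<⇒≤ (proj₂ (high (proj₁ (match p∈)))))
      where
      many : ∀ {x} → x ∈ xs → K < earlier x (suc c)
      many x∈ with high x∈
      ... | (inj₁ x≤c , _) , c+T<x = contradiction (≤-trans x≤c (m≤m+n c T)) (<⇒≱ c+T<x)
      ... | (inj₂ p , _)   , _     = p

    -- Each such vertex remains because of an out-neighbour `v` that has out-degree at least `c` and
    -- at most `K` in-neighbours of out-degree below `c`. As all of `xs` is below `c`, one `v`
    -- serves at most `K` of them, and a greedy choice leaves `K` disjoint edges.
    low⇒subgraph : ∀ c {xs} → Unique xs → lowBound h k ≤ length xs →
      (∀ {x} → x ∈ xs → InBag c x × outdegree x + T < c) → SemicompleteSubgraph k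
    low⇒subgraph c {xs} uxs len low = build (pairUp xs target)
      where
      target : ∀ {x} → x ∈ xs → ∃[ v ] (x ⟶ v × c ≤ outdegree v × earlier v c ≤ K)
      target {x} x∈ with low x∈
      ... | (_ , inj₁ c≤x) , x+T<c = contradiction (≤-trans c≤x (m≤m+n (outdegree x) T)) (<⇒≱ x+T<c)
      ... | (_ , inj₂ v)   , _     = v

      -- Reflexive on the pairs in question, which makes conflict-free pairs distinct in both components.
      conflict? : Decidable₂ (λ (p q : V × V) → proj₁ q ⟶ proj₂ p)
      conflict? p q = proj₁ q ⟶? proj₂ p

      build : ∃[ ps ] (map proj₁ ps ≡ xs ×
                       (∀ {u v} → (u , v) ∈ ps → u ⟶ v × c ≤ outdegree v × earlier v c ≤ K)) →
              SemicompleteSubgraph k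
      build (ps , refl , good) with greedy conflict? K K ps (≤-trans len (≤-reflexive (length-map proj₁ ps)))
      ... | inj₁ (p , p∈ , many) =
            contradiction (≤-trans (≤-reflexive (count-map (_⟶? proj₂ p) proj₁ ps))
                             (≤-trans (count≤count-allFin (_⟶? proj₂ p) (earlier? (proj₂ p) c) uxs
                                         (λ x∈ e → e , ≤-<-trans (m≤m+n _ T) (proj₂ (low x∈))))
                                      (proj₂ (proj₂ (good p∈)))))
                          (<⇒≱ many)
      ... | inj₂ (qs , qs⊆ , len-qs , free) =
            matching⇒subgraph sc k (≤-reflexive (sym len-qs))
              (AllPairs.map⁺ (distinct qs⊆ free (λ { p∈ _ refl → proj₁ (good p∈) })))
              (AllPairs.map⁺ (distinct qs⊆ free (λ { _ q∈ refl → proj₁ (good q∈) })))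
              (proj₁ ∘ good ∘ qs⊆)
              λ p∈ q∈ → ≤-trans (<⇒≤ (proj₂ (low (∈-map⁺ proj₁ (qs⊆ q∈))))) (proj₁ (proj₂ (good (qs⊆ p∈))))
        where
        distinct : ∀ {f : V × V → V} {rs} → rs ⊆ ps → AllPairs (λ p q → ¬ (proj₁ q ⟶ proj₂ p)) rs →
                   (∀ {p q} → p ∈ ps → q ∈ ps → f p ≡ f q → proj₁ q ⟶ proj₂ p) →
                   AllPairs (_≢_ on f) rs
        distinct rs⊆ []       clash = []
        distinct rs⊆ (r ∷ rs) clash =
          All.tabulate (λ q∈ eq → All.lookup r q∈ (clash (rs⊆ (here refl)) (rs⊆ (there q∈)) eq)) ∷
          distinct (rs⊆ ∘ there) rs clash

    -- Sorting a large bag by out-degree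

    pathwidth⇒subgraph : 0 < k → PathwidthAtLeast G (bound h k) → SemicompleteSubgraph k
    pathwidth⇒subgraph 0<k pw with pw decomposition
    ... | i , large = conclude (+-≤-split (windowBound h k) sizes)
      where
      open ≤-Reasoning
      c = toℕ i
      xs = elements (X decomposition i)
      uxs : Unique xs
      uxs = elements-unique (X decomposition i)
      inBag : ∀ {x} → x ∈ xs → InBag c x
      inBag x∈ = ∈-comprehension⁻ (inBag? c) (∈-elements⁻ x∈)

      window? : Decidable (λ x → c ≤ outdegree x + T × outdegree x ≤ c + T)
      window? x = (c ≤? outdegree x + T) ×-dec (outdegree x ≤? c + T)
      high? : Decidable (λ x → c + T < outdegree x)
      high? x = c + T <? outdegree x
      low? : Decidable (λ x → outdegree x + T < c)
      low? x = outdegree x + T <? c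

      split : ∀ {x} → ¬ (c ≤ outdegree x + T × outdegree x ≤ c + T) → c + T < outdegree x ⊎ outdegree x + T < c
      split {x} ¬w with c ≤? outdegree x + T
      ... | no c≰  = inj₂ (≰⇒> c≰)
      ... | yes c≤ = inj₁ (≰⇒> (λ x≤ → ¬w (c≤ , x≤)))

      sizes : bound h k ≤ count window? xs + (count high? xs + count low? xs)
      sizes = begin
        bound h k                                            ≤⟨ n≤1+n _ ⟩
        suc (bound h k)                                      ≤⟨ large ⟩
        ∣ X decomposition i ∣                                ≡⟨ length-elements (X decomposition i) ⟨
        length xs                                            ≤⟨ length-cover window? (¬? ∘ window?) xs (λ {x} _ → decide (window? x)) ⟩
        count window? xs + count (¬? ∘ window?) xs           ≤⟨ +-monoʳ-≤ (count window? xs)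
                                                                  (count-cover (¬? ∘ window?) high? low? xs (λ {x} _ → split {x})) ⟩
        count window? xs + (count high? xs + count low? xs)  ∎

      conclude : windowBound h k ≤ count window? xs ⊎ K + lowBound h k ≤ count high? xs + count low? xs →
                 SemicompleteSubgraph k
      conclude (inj₁ many) =
        window⇒subgraph sc k c 0<k (Unique.filter⁺ window? uxs) many (λ x∈ → proj₂ (∈-filter⁻ window? {xs = xs} x∈))
      conclude (inj₂ many) with +-≤-split K many
      ... | inj₁ many-high = high⇒subgraph c (Unique.filter⁺ high? uxs) many-high
              (λ x∈ → let x∈xs , hi = ∈-filter⁻ high? {xs = xs} x∈ in inBag x∈xs , hi)
      ... | inj₂ many-low = low⇒subgraph c (Unique.filter⁺ low? uxs) many-low
              (λ x∈ → let x∈xs , lo = ∈-filter⁻ low? {xs = xs} x∈ in inBag x∈xs , lo)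

theorem2 : Σ (ℕ → ℕ → ℕ) λ f →
    ∀ (h k : ℕ) → 1 ≤ h → 1 ≤ k →
    ∀ (G : Digraph) → SemicompleteH h G → PathwidthAtLeast G (f h k) →
    ∃[ H ] (IsSubgraph H G × Semicomplete H × PathwidthAtLeast H k)
theorem2 = bound , λ h k _ 1≤k G sc pw → pathwidth⇒subgraph G sc k 1≤k pw
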